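{- Let $G$ be a connected graph of order $n$. If $\sigma_2(G)\ge n-k+1$ for some positive integer $k$, then $G$ has a spanning tree $T$ such that $\sum_{v\in B(T)} d_T(v)\le \frac{3}{2}(k-1)$, where $B(T)$ is the set of branch vertices of $T$.
   Context: All graphs are finite, undirected, without loops or multiple edges. For a graph $G$, $\sigma_2(G)$ denotes the minimum of $d_G(u)+d_G(v)$ over all pairs of distinct nonadjacent vertices $u,v$ of $G$; if $G$ has no two nonadjacent vertices (i.e. $G$ is complete), $\sigma_2(G)=+\infty$. A branch vertex of a tree $T$ is a vertex of degree at least three in $T$; $B(T)$ denotes the set of branch vertices of $T$, and $d_T(v)$ the degree of $v$ in $T$ (the sum over an empty set is $0$). -}

module Defs where

open import Data.Nat using (ℕ; zero; suc; _+_; _*_; _∸_; _≤_)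
open import Data.Fin using (Fin)
open import Data.Bool using (Bool; true; false; T; if_then_else_)
open import Data.List using (List; []; _∷_; length; map; filter)
open import Data.Nat.ListAction using (sum)
open import Data.List.Base using (allFin)
open import Data.List.Relation.Unary.Unique.Propositional using (Unique)
open import Relation.Binary.PropositionalEquality using (_≡_)
open import Relation.Nullary using (¬_)
open import Data.Product using (_×_; ∃)

record Graph (n : ℕ) : Set where
  field
    adj   : Fin n → Fin n → Bool
    sym   : ∀ u v → adj u v ≡ adj v u
    irrefl : ∀ v → adj v v ≡ false
open Graph public

deg : ∀ {n} → Graph n → Fin n → ℕ
deg G v = length (filter (λ u → T? (adj G v u)) (allFin _))
  where
  open import Relation.Nullary.Decidable using (Dec; yes; no)
  T? : (b : Bool) → Dec (T b)
  T? true  = yes _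
  T? false = no (λ ())

Adj : ∀ {n} → Graph n → Fin n → Fin n → Set
Adj G u v = T (adj G u v)

data Walk {n} (G : Graph n) : Fin n → Fin n → List (Fin n) → Set where
  here : ∀ v → Walk G v v (v ∷ [])
  step : ∀ {u w v xs} → Adj G u w → Walk G w v xs → Walk G u v (u ∷ xs)

Connected : ∀ {n} → Graph n → Set
Connected G = ∀ u v → ∃ (λ xs → Walk G u v xs)

HasCycle : ∀ {n} → Graph n → Set
HasCycle {n} G = ∃ λ u → ∃ λ v → ∃ λ xs →
  Walk G u v xs × Unique xs × (3 ≤ length xs) × Adj G v u

IsTree : ∀ {n} → Graph n → Set
IsTree G = Connected G × ¬ HasCycle G

IsSpanningTree : ∀ {n} → Graph n → Graph n → Set
IsSpanningTree {n} G T' = (∀ u v → Adj T' u v → Adj G u v) × IsTree T'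

-- σ₂(G) ≥ m: every pair of distinct nonadjacent vertices has degree sum ≥ m
-- (vacuous when G is complete, matching σ₂ = +∞).
σ₂≥ : ∀ {n} → Graph n → ℕ → Set
σ₂≥ G m = ∀ u v → ¬ (u ≡ v) → ¬ Adj G u v → m ≤ deg G u + deg G v

branchDegSum : ∀ {n} → Graph n → ℕ
branchDegSum {n} T' = sum (map (λ v → if 3 ≤ᵇ deg T' v then deg T' v else 0) (allFin n))
  where open import Data.Nat using (_≤ᵇ_)

{-# OPTIONS --safe #-}
module Submission where

-- Among the spanning trees of G consider one with as many vertices of degree two as possible; let D
-- be their number. If it has a branch vertex, it has leaves u ≠ v, nonadjacent in G, with
-- d_G(u) + d_G(v) ≤ D + 2, so that D ≥ n - k - 1. Since every d ≥ 1 satisfies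
-- 2 [d ≥ 3] d + 3 [d = 2] + 3 ≤ 3 d, and the degrees of the tree add up to 2 n - 2, summation gives
-- 2 Σ_B d ≤ 3 n - 3 D - 6 ≤ 3 (k - 1).
--
-- For the inequality, let t be the branch vertex closest to v, and for w ≠ u let p(w) be the
-- neighbour of w on the tree path to u. Exchanging edges shows that p(w) has degree two whenever
-- w ∈ N_G(u) and p(w) ≠ u, and that every w ∈ N_G(v) other than t has degree two, provided no leg at
-- t can be moved to another branch vertex. That is achieved by taking t with at most one neighbour
-- that does not start a path to a leaf, and moving its legs away one by one: either this stops, or
-- the degree of t drops to two. Moreover p is injective on N_G(u), and p(N_G(u)) misses N_G(v): if
-- v is adjacent to x = p(w), then in T + uw - wx both x and v are leaves, and joining them gives a
-- better tree. Hence p(N_G(u)) and N_G(v) are disjoint and, apart from u and t, of degree two.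

open import Defs hiding (sym)
open import Data.Nat using (ℕ; zero; suc; _+_; _*_; _∸_; _≤_; _<_; z≤n; s≤s; _≡ᵇ_; _≤ᵇ_; _≤?_; _<?_)
open import Data.Nat.ListAction using () renaming (sum to listSum)
open import Data.Nat.Properties renaming (_≟_ to _≟ℕ_)
open import Data.Nat.Solver using (module +-*-Solver)
open import Data.Bool using (Bool; true; false; T; _∧_; _∨_; not; if_then_else_)
open import Data.Bool.Properties using (∧-comm; ∨-comm; T?)
open import Data.Empty using (⊥; ⊥-elim)
open import Data.Fin using (Fin; zero; suc)
open import Data.Fin.Properties using (_≟_; any?)
open import Data.List using (length; filter; tabulate; map)
open import Data.List.Relation.Unary.All using (All; _∷_)
open import Data.List.Relation.Unary.AllPairs using (_∷_)
open import Data.Product using (Σ; ∃; _×_; _,_; proj₁; proj₂)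
open import Data.Sum using (_⊎_; inj₁; inj₂)
open import Function using (_∘_; id)
open import Relation.Binary.Construct.Closure.ReflexiveTransitive using (Star; ε; _◅_; _◅◅_; reverse; fold)
open import Relation.Binary.PropositionalEquality using (_≡_; _≢_; refl; sym; trans; cong; cong₂; subst; module ≡-Reasoning)
open import Relation.Nullary using (¬_; Dec; yes; no; does; contradiction)
open import Relation.Nullary.Decidable using (_×-dec_; ¬?)
open import Relation.Unary using (Decidable)
open import Algebra.Properties.CommutativeMonoid.Sum +-0-commutativeMonoid using (sum; sum-cong-≗; sum-replicate-zero; ∑-distrib-+; ∑-comm)
open import Algebra.Properties.CommutativeSemigroup +-commutativeSemigroup using () renaming (interchange to +-interchange)

private variable
  n : ℕ

-- Sums over Fin n

sum-mono-≤ : {f g : Fin n → ℕ} → (∀ i → f i ≤ g i) → sum f ≤ sum g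
sum-mono-≤ {zero}  f≤g = z≤n
sum-mono-≤ {suc n} f≤g = +-mono-≤ (f≤g zero) (sum-mono-≤ (f≤g ∘ suc))

-- A termwise inequality without slack in total has no slack in any term. This turns the edge count
-- of a tree into a description of its edges.
sum-≤⇒≡ : {f g : Fin n → ℕ} → (∀ i → f i ≤ g i) → sum g ≤ sum f → ∀ i → f i ≡ g i
sum-≤⇒≡ {suc n} {f} {g} f≤g Σg≤Σf zero = ≤-antisym (f≤g zero)
  (+-cancelʳ-≤ _ _ _ (≤-trans Σg≤Σf (+-monoʳ-≤ (f zero) (sum-mono-≤ (f≤g ∘ suc)))))
sum-≤⇒≡ {suc n} {f} {g} f≤g Σg≤Σf (suc i) = sum-≤⇒≡ (f≤g ∘ suc)
  (+-cancelˡ-≤ (g zero) _ _ (≤-trans Σg≤Σf (+-monoˡ-≤ _ (f≤g zero)))) i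

sum-<⇒∃< : (f g : Fin n → ℕ) → sum f < sum g → ∃ λ i → f i < g i
sum-<⇒∃< f g Σf<Σg with any? (λ i → f i <? g i)
... | yes f<g = f<g
... | no ¬f<g = contradiction (sum-mono-≤ (λ i → ≮⇒≥ (λ f<g → ¬f<g (i , f<g)))) (<⇒≱ Σf<Σg)

sum-const : ∀ c → sum {n} (λ _ → c) ≡ n * c
sum-const {zero}  c = refl
sum-const {suc n} c = cong (c +_) (sum-const {n} c)

sum-* : ∀ c (f : Fin n → ℕ) → sum (λ i → c * f i) ≡ c * sum f
sum-* {zero}  c f = sym (*-zeroʳ c)
sum-* {suc n} c f = trans (cong (c * f zero +_) (sum-* c (f ∘ suc))) (sym (*-distribˡ-+ c _ _))

ι : Bool → ℕ
ι true  = 1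
ι false = 0

δ : Fin n → Fin n → ℕ
δ a x = ι (does (x ≟ a))

δ-refl : (a : Fin n) → δ a a ≡ 1
δ-refl a with a ≟ a
... | yes _  = refl
... | no a≢a = contradiction refl a≢a

δ-≢ : {a x : Fin n} → x ≢ a → δ a x ≡ 0
δ-≢ {a = a} {x} x≢a with x ≟ a
... | yes x≡a = contradiction x≡a x≢a
... | no _    = refl

sum-δ : (a : Fin n) → sum (δ a) ≡ 1
sum-δ {suc n} zero    = cong suc (trans (sum-const {n} 0) (*-zeroʳ n))
sum-δ {suc n} (suc a) = sum-δ a

sum-*δ : ∀ c (a : Fin n) → sum (λ x → c * δ a x) ≡ c
sum-*δ c a = trans (sum-* c (δ a)) (trans (cong (c *_) (sum-δ a)) (*-identityʳ c))

term≤sum : (f : Fin n → ℕ) → ∀ i → f i ≤ sum f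
term≤sum f zero    = m≤m+n _ _
term≤sum f (suc i) = ≤-trans (term≤sum (f ∘ suc) i) (m≤n+m _ _)

sum-unique≤1 : (f : Fin n → ℕ) → (∀ i → f i ≤ 1) → (∀ i j → 0 < f i → 0 < f j → i ≡ j) → sum f ≤ 1
sum-unique≤1 {n} f f≤1 unique with any? (λ i → 0 <? f i)
... | no none = ≤-trans (sum-mono-≤ (λ i → ≮⇒≥ (λ 0<f → none (i , 0<f))))
  (≤-trans (≤-reflexive (sum-replicate-zero n)) z≤n)
... | yes (i , 0<fi) = ≤-trans (sum-mono-≤ bound) (≤-reflexive (sum-δ i))
  where
  bound : ∀ j → f j ≤ δ i j
  bound j with j ≟ i
  ... | yes _  = f≤1 j
  ... | no j≢i = ≮⇒≥ (λ 0<fj → j≢i (unique j i 0<fj 0<fi))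

ι-T : ∀ {b} → T b → ι b ≡ 1
ι-T {true} _ = refl

ι-¬T : ∀ {b} → ¬ T b → ι b ≡ 0
ι-¬T {true}  ¬b = contradiction _ ¬b
ι-¬T {false} _  = refl

ι≤1 : ∀ b → ι b ≤ 1
ι≤1 true  = ≤-refl
ι≤1 false = z≤n

-- Degrees

-- The decision procedure is a parameter because `deg` filters with one that is local to its
-- definition.
length-filter-tabulate : {A : Set} (f : A → Bool) (f? : ∀ x → Dec (T (f x))) (g : Fin n → A) →
  length (filter f? (tabulate g)) ≡ sum (λ i → ι (f (g i)))
length-filter-tabulate {zero}  f f? g = refl
length-filter-tabulate {suc n} f f? g with f (g zero) | f? (g zero)
... | true  | yes _ = cong suc (length-filter-tabulate f f? (g ∘ suc))
... | true  | no ¬t = contradiction _ ¬t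
... | false | no _  = length-filter-tabulate f f? (g ∘ suc)

deg≡sum : (G : Graph n) (x : Fin n) → deg G x ≡ sum (λ y → ι (adj G x y))
deg≡sum G x = length-filter-tabulate (adj G x) _ id

Adj-sym : (G : Graph n) {x y : Fin n} → Adj G x y → Adj G y x
Adj-sym G {x} {y} = subst T (Graph.sym G x y)

Adj⇒≢ : (G : Graph n) {x y : Fin n} → Adj G x y → x ≢ y
Adj⇒≢ G {x} xy refl = subst T (irrefl G x) xy

Adj? : (G : Graph n) (x y : Fin n) → Dec (Adj G x y)
Adj? G x y = T? (adj G x y)

module _ (G : Graph n) {x : Fin n} where

  1≤deg : ∀ {a} → Adj G x a → 1 ≤ deg G x
  1≤deg {a} xa rewrite deg≡sum G x = ≤-trans (≤-reflexive (sym (sum-δ a))) (sum-mono-≤ bound)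
    where
    bound : ∀ y → δ a y ≤ ι (adj G x y)
    bound y with y ≟ a
    ... | yes refl = ≤-reflexive (sym (ι-T xa))
    ... | no _     = z≤n

  2≤deg : ∀ {a b} → Adj G x a → Adj G x b → a ≢ b → 2 ≤ deg G x
  2≤deg {a} {b} xa xb a≢b rewrite deg≡sum G x = ≤-trans
    (≤-reflexive (sym (trans (∑-distrib-+ (δ a) (δ b)) (cong₂ _+_ (sum-δ a) (sum-δ b)))))
    (sum-mono-≤ bound)
    where
    bound : ∀ y → δ a y + δ b y ≤ ι (adj G x y)
    bound y with y ≟ a | y ≟ b
    ... | yes refl | yes refl = contradiction refl a≢b
    ... | yes refl | no _     = ≤-reflexive (sym (ι-T xa))
    ... | no _     | yes refl = ≤-reflexive (sym (ι-T xb))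
    ... | no _     | no _     = z≤n

  3≤deg : ∀ {a b c} → Adj G x a → Adj G x b → Adj G x c → a ≢ b → a ≢ c → b ≢ c → 3 ≤ deg G x
  3≤deg {a} {b} {c} xa xb xc a≢b a≢c b≢c rewrite deg≡sum G x = ≤-trans
    (≤-reflexive (sym (trans (∑-distrib-+ (δ a) (λ y → δ b y + δ c y))
      (cong₂ _+_ (sum-δ a) (trans (∑-distrib-+ (δ b) (δ c)) (cong₂ _+_ (sum-δ b) (sum-δ c)))))))
    (sum-mono-≤ bound)
    where
    bound : ∀ y → δ a y + (δ b y + δ c y) ≤ ι (adj G x y)
    bound y with y ≟ a | y ≟ b | y ≟ c
    ... | yes refl | yes refl | _        = contradiction refl a≢b
    ... | yes refl | no _     | yes refl = contradiction refl a≢c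
    ... | no _     | yes refl | yes refl = contradiction refl b≢c
    ... | yes refl | no _     | no _     = ≤-reflexive (sym (ι-T xa))
    ... | no _     | yes refl | no _     = ≤-reflexive (sym (ι-T xb))
    ... | no _     | no _     | yes refl = ≤-reflexive (sym (ι-T xc))
    ... | no _     | no _     | no _     = z≤n

  -- Row `x` of the adjacency matrix has a larger sum than `δ a`, hence a larger entry at some `y`,
  -- and this `y` cannot be `a`.
  another-neighbour : 2 ≤ deg G x → ∀ a → ∃ λ y → Adj G x y × y ≢ a
  another-neighbour 2≤d a with sum-<⇒∃< (δ a) (λ y → ι (adj G x y))
    (≤-trans (s≤s (≤-reflexive (sum-δ a))) (≤-trans 2≤d (≤-reflexive (deg≡sum G x))))
  ... | y , δ<ι with y ≟ a | adj G x y in eq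
  ... | yes refl | true  = contradiction δ<ι (λ { (s≤s ()) })
  ... | no y≢a   | true  = y , subst T (sym eq) _ , y≢a

-- Adding and deleting an edge

edge : (a b x y : Fin n) → Bool
edge a b x y = (does (x ≟ a) ∧ does (y ≟ b)) ∨ (does (x ≟ b) ∧ does (y ≟ a))

edge-sym : (a b x y : Fin n) → edge a b x y ≡ edge a b y x
edge-sym a b x y = trans (∨-comm (does (x ≟ a) ∧ does (y ≟ b)) _)
  (cong₂ _∨_ (∧-comm (does (x ≟ b)) _) (∧-comm (does (x ≟ a)) _))

edge-ends : {a b x y : Fin n} → T (edge a b x y) → (x ≡ a × y ≡ b) ⊎ (x ≡ b × y ≡ a)
edge-ends {a = a} {b} {x} {y} e with x ≟ a | y ≟ b | x ≟ b | y ≟ a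
... | yes p | yes q | _     | _     = inj₁ (p , q)
... | yes _ | no _  | yes p | yes q = inj₂ (p , q)
... | no _  | _     | yes p | yes q = inj₂ (p , q)

edge-refl : (a b : Fin n) → T (edge a b a b)
edge-refl a b with a ≟ a | b ≟ b
... | yes _ | yes _  = _
... | no a≢a | _     = contradiction refl a≢a
... | yes _ | no b≢b = contradiction refl b≢b

edge-irrefl : {a b : Fin n} → a ≢ b → ∀ x → edge a b x x ≡ false
edge-irrefl {a = a} {b} a≢b x with x ≟ a | x ≟ b
... | yes refl | yes refl = contradiction refl a≢b
... | yes _    | no _     = refl
... | no _     | yes _    = refl
... | no _     | no _     = refl

sum-edge : {a b : Fin n} → a ≢ b → ∀ x → sum (λ y → ι (edge a b x y)) ≡ δ a x + δ b x
sum-edge {a = a} {b} a≢b x = begin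
  sum (λ y → ι (edge a b x y))                              ≡⟨ sum-cong-≗ split ⟩
  sum (λ y → δ a x * δ b y + δ b x * δ a y)                  ≡⟨ ∑-distrib-+ (λ y → δ a x * δ b y) _ ⟩
  sum (λ y → δ a x * δ b y) + sum (λ y → δ b x * δ a y)       ≡⟨ cong₂ _+_ (sum-*δ (δ a x) b) (sum-*δ (δ b x) a) ⟩
  δ a x + δ b x                                             ∎
  where
  open ≡-Reasoning
  split : ∀ y → ι (edge a b x y) ≡ δ a x * δ b y + δ b x * δ a y
  split y with x ≟ a | y ≟ b | x ≟ b | y ≟ a
  ... | yes refl | _     | yes refl | _     = contradiction refl a≢b
  ... | yes _    | yes _ | no _     | _     = refl
  ... | yes _    | no _  | no _     | _     = refl
  ... | no _     | _     | yes _    | yes _ = refl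
  ... | no _     | _     | yes _    | no _  = refl
  ... | no _     | _     | no _     | _     = refl

addEdge : (G : Graph n) {a b : Fin n} → a ≢ b → Graph n
addEdge G {a} {b} a≢b = record
  { adj    = λ x y → adj G x y ∨ edge a b x y
  ; sym    = λ x y → cong₂ _∨_ (Graph.sym G x y) (edge-sym a b x y)
  ; irrefl = λ x → cong₂ _∨_ (irrefl G x) (edge-irrefl a≢b x)
  }

delEdge : Graph n → Fin n → Fin n → Graph n
delEdge G a b = record
  { adj    = λ x y → adj G x y ∧ not (edge a b x y)
  ; sym    = λ x y → cong₂ _∧_ (Graph.sym G x y) (cong not (edge-sym a b x y))
  ; irrefl = λ x → cong (_∧ not (edge a b x x)) (irrefl G x)
  }

module _ (G : Graph n) {a b : Fin n} where

  deg-addEdge : (a≢b : a ≢ b) → ¬ Adj G a b → ∀ x → deg (addEdge G a≢b) x ≡ deg G x + (δ a x + δ b x)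
  deg-addEdge a≢b ¬ab x = begin
    deg (addEdge G a≢b) x                                        ≡⟨ deg≡sum (addEdge G a≢b) x ⟩
    sum (λ y → ι (adj G x y ∨ edge a b x y))                     ≡⟨ sum-cong-≗ split ⟩
    sum (λ y → ι (adj G x y) + ι (edge a b x y))                 ≡⟨ ∑-distrib-+ (λ y → ι (adj G x y)) _ ⟩
    sum (λ y → ι (adj G x y)) + sum (λ y → ι (edge a b x y))     ≡⟨ cong₂ _+_ (sym (deg≡sum G x)) (sum-edge a≢b x) ⟩
    deg G x + (δ a x + δ b x)                                    ∎
    where
    open ≡-Reasoning
    split : ∀ y → ι (adj G x y ∨ edge a b x y) ≡ ι (adj G x y) + ι (edge a b x y)
    split y with adj G x y in xy | edge a b x y in e
    ... | false | _     = refl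
    ... | true  | false = refl
    ... | true  | true  with edge-ends {x = x} {y} (subst T (sym e) _)
    ... | inj₁ (refl , refl) = contradiction (subst T (sym xy) _) ¬ab
    ... | inj₂ (refl , refl) = contradiction (Adj-sym G (subst T (sym xy) _)) ¬ab

  deg-delEdge : Adj G a b → ∀ x → deg (delEdge G a b) x + (δ a x + δ b x) ≡ deg G x
  deg-delEdge ab x = begin
    deg (delEdge G a b) x + (δ a x + δ b x)
      ≡⟨ cong₂ _+_ (deg≡sum (delEdge G a b) x) (sym (sum-edge (Adj⇒≢ G ab) x)) ⟩
    sum (λ y → ι (adj G x y ∧ not (edge a b x y))) + sum (λ y → ι (edge a b x y))
      ≡⟨ sym (∑-distrib-+ (λ y → ι (adj G x y ∧ not (edge a b x y))) _) ⟩
    sum (λ y → ι (adj G x y ∧ not (edge a b x y)) + ι (edge a b x y))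
      ≡⟨ sum-cong-≗ split ⟩
    sum (λ y → ι (adj G x y))
      ≡⟨ sym (deg≡sum G x) ⟩
    deg G x ∎
    where
    open ≡-Reasoning
    split : ∀ y → ι (adj G x y ∧ not (edge a b x y)) + ι (edge a b x y) ≡ ι (adj G x y)
    split y with adj G x y in xy | edge a b x y in e
    ... | true  | true  = refl
    ... | true  | false = refl
    ... | false | false = refl
    ... | false | true  with edge-ends {x = x} {y} (subst T (sym e) _)
    ... | inj₁ (refl , refl) = ⊥-elim (subst T xy ab)
    ... | inj₂ (refl , refl) = ⊥-elim (subst T xy (Adj-sym G ab))

  addEdge-old : (a≢b : a ≢ b) → ∀ {x y} → Adj G x y → Adj (addEdge G a≢b) x y
  addEdge-old a≢b {x} {y} xy with adj G x y
  ... | true = _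

  addEdge-new : (a≢b : a ≢ b) → Adj (addEdge G a≢b) a b
  addEdge-new a≢b with adj G a b
  ... | true  = _
  ... | false = edge-refl a b

  addEdge-Adj : (a≢b : a ≢ b) → ∀ {x y} → Adj (addEdge G a≢b) x y → Adj G x y ⊎ T (edge a b x y)
  addEdge-Adj a≢b {x} {y} xy with adj G x y
  ... | true  = inj₁ _
  ... | false = inj₂ xy

  delEdge-keep : ∀ {x y} → Adj G x y → ¬ T (edge a b x y) → Adj (delEdge G a b) x y
  delEdge-keep {x} {y} xy ¬e with adj G x y | edge a b x y
  ... | true | false = _
  ... | true | true  = contradiction _ ¬e

  delEdge-Adj : ∀ {x y} → Adj (delEdge G a b) x y → Adj G x y × ¬ T (edge a b x y)
  delEdge-Adj {x} {y} xy with adj G x y | edge a b x y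
  ... | true | false = _ , λ ()

-- Breadth-first search

Linked : Graph n → Set
Linked G = ∀ x y → Star (Adj G) x y

Star-reverse : (G : Graph n) {x y : Fin n} → Star (Adj G) x y → Star (Adj G) y x
Star-reverse G = reverse (Adj-sym G)

Connected⇒Linked : {G : Graph n} → Connected G → Linked G
Connected⇒Linked {G = G} conn x y = walk⇒star (proj₂ (conn x y))
  where
  walk⇒star : ∀ {x y xs} → Walk G x y xs → Star (Adj G) x y
  walk⇒star (here _)   = ε
  walk⇒star (step e w) = e ◅ walk⇒star w

Linked⇒Connected : {G : Graph n} → Linked G → Connected G
Linked⇒Connected {G = G} link x y = star⇒walk (link x y)
  where
  star⇒walk : ∀ {x y} → Star (Adj G) x y → ∃ λ xs → Walk G x y xs
  star⇒walk ε       = _ , here _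
  star⇒walk (e ◅ s) = _ , step e (proj₂ (star⇒walk s))

-- The fields force `depth` to be the distance from `r`. The value `parent r` is left unspecified,
-- hence the guards `x ≢ r`.
record Rooted (G : Graph n) (r : Fin n) : Set where
  field
    depth        : Fin n → ℕ
    parent       : Fin n → Fin n
    depth-root   : depth r ≡ 0
    parent-adj   : ∀ {x} → x ≢ r → Adj G x (parent x)
    depth-parent : ∀ {x} → x ≢ r → depth x ≡ suc (depth (parent x))
    depth-adj    : ∀ {x y} → Adj G x y → depth y ≤ suc (depth x)

least : {P : ℕ → Set} → (∀ k → Dec (P k)) → ∀ m → P m → ∃ λ k → P k × (∀ j → P j → k ≤ j)
least P? m pm with P? 0
... | yes p₀ = 0 , p₀ , λ _ _ → z≤n
least P? zero    pm | no ¬p₀ = contradiction pm ¬p₀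
least P? (suc m) pm | no ¬p₀ with least (P? ∘ suc) m pm
... | k , pk , min = suc k , pk , λ { zero p₀ → contradiction p₀ ¬p₀ ; (suc j) pj → s≤s (min j pj) }

argmin : {P : Fin n → Set} → Decidable P → (f : Fin n → ℕ) → ∃ P → ∃ λ x → P x × (∀ y → P y → f x ≤ f y)
argmin P? f (x₀ , px₀) with least (λ k → any? (λ x → P? x ×-dec (f x ≟ℕ k))) (f x₀) (x₀ , px₀ , refl)
... | _ , (x , px , refl) , min = x , px , λ y py → min (f y) (y , py , refl)

argmax : {P : Fin n → Set} → Decidable P → (f : Fin n → ℕ) → ∃ P → ∃ λ x → P x × (∀ y → P y → f y ≤ f x)
-- No value exceeds `sum f`, so truncated subtraction from it reverses the order faithfully.
argmax P? f ∃P with argmin P? (λ x → sum f ∸ f x) ∃P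
... | x , px , min = x , px , λ y py → ∸-cancelʳ-≤ (term≤sum f y) (min y py)

module _ (G : Graph n) (r : Fin n) where

  Reach : ℕ → Fin n → Set
  Reach zero    x = x ≡ r
  Reach (suc k) x = ∃ λ y → Adj G x y × Reach k y

  reach? : ∀ k x → Dec (Reach k x)
  reach? zero    x = x ≟ r
  reach? (suc k) x = any? (λ y → Adj? G x y ×-dec reach? k y)

  star⇒reach : ∀ {x} → Star (Adj G) x r → ∃ λ k → Reach k x
  star⇒reach ε       = 0 , refl
  star⇒reach (e ◅ s) = let k , reach = star⇒reach s in suc k , _ , e , reach

  -- The depth of `x` is the length of a shortest walk to `r`, and the first step of such a walk
  -- leads to the parent.
  root : Linked G → Rooted G r
  root link = record
    { depth        = depth
    ; parent       = λ x → step-to x (depth x) (reached x)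
    ; depth-root   = n≤0⇒n≡0 (minimal r 0 refl)
    ; parent-adj   = λ {x} x≢r → proj₁ (step-to-spec x≢r (depth x) (reached x))
    ; depth-parent = λ {x} x≢r → let xp , reach = step-to-spec x≢r (depth x) (reached x) in
        ≤-antisym (depth-adj (Adj-sym G xp)) reach
    ; depth-adj    = depth-adj
    }
    where
    shortest : ∀ x → ∃ λ k → Reach k x × (∀ j → Reach j x → k ≤ j)
    shortest x = let k , reach = star⇒reach (link x r) in least (λ j → reach? j x) k reach
    depth : Fin n → ℕ
    depth x = proj₁ (shortest x)
    reached : ∀ x → Reach (depth x) x
    reached x = proj₁ (proj₂ (shortest x))
    minimal : ∀ x j → Reach j x → depth x ≤ j
    minimal x = proj₂ (proj₂ (shortest x))
    depth-adj : ∀ {x y} → Adj G x y → depth y ≤ suc (depth x)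
    depth-adj {x} xy = minimal _ _ (x , Adj-sym G xy , reached x)
    step-to : ∀ x k → Reach k x → Fin n
    -- Depth zero occurs only at `r`; the value there is a default.
    step-to x zero    _       = x
    step-to x (suc k) (y , _) = y
    step-to-spec : ∀ {x} → x ≢ r → ∀ k (reach : Reach k x) →
      Adj G x (step-to x k reach) × suc (depth (step-to x k reach)) ≤ k
    step-to-spec x≢r zero    x≡r            = contradiction x≡r x≢r
    step-to-spec x≢r (suc k) (y , xy , reach) = xy , s≤s (minimal y k reach)

-- Paths towards the root, and the number of edges

module _ {G : Graph n} {r : Fin n} (ρ : Rooted G r) where
  open Rooted ρ

  <depth⇒≢root : ∀ {m x} → m < depth x → x ≢ r
  <depth⇒≢root m<d refl = n≮0 (subst (_ <_) depth-root m<d)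

  depth≡0⇒root : ∀ {x} → depth x ≡ 0 → x ≡ r
  depth≡0⇒root {x} d≡0 with x ≟ r
  ... | yes x≡r = x≡r
  ... | no x≢r  = contradiction (trans (sym d≡0) (depth-parent x≢r)) (λ ())

  depth<⇒≢ : ∀ {x y} → depth x < depth y → x ≢ y
  depth<⇒≢ x<y refl = <-irrefl refl x<y

  parent< : ∀ {x} → x ≢ r → depth (parent x) < depth x
  parent< x≢r = ≤-reflexive (sym (depth-parent x≢r))

  -- Follows parents from `x` down to depth `m`. The relation `R` is arbitrary so that the path can
  -- be taken in a graph that has lost an edge elsewhere: only the parent edges actually traversed
  -- must survive.
  descend : {R : Fin n → Fin n → Set} → ∀ m x → m ≤ depth x →
    (∀ y → m < depth y → depth y ≤ depth x → R y (parent y)) →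
    ∃ λ z → depth z ≡ m × Star R x z
  descend {R} m x m≤d = go (depth x ∸ m) x (sym (m∸n+n≡m m≤d))
    where
    go : ∀ k x → depth x ≡ k + m → (∀ y → m < depth y → depth y ≤ depth x → R y (parent y)) →
         ∃ λ z → depth z ≡ m × Star R x z
    go zero    x d≡ up = x , d≡ , ε
    go (suc k) x d≡ up =
      let m<d = subst (m <_) (sym d≡) (s≤s (m≤n+m m k))
          x≢r = <depth⇒≢root m<d
          z , dz , s = go k (parent x) (suc-injective (trans (sym (depth-parent x≢r)) d≡))
                         (λ y m<y y≤p → up y m<y (≤-trans y≤p (<⇒≤ (parent< x≢r))))
      in z , dz , up x m<d ≤-refl ◅ s

  descend-to-root : {R : Fin n → Fin n → Set} → ∀ x →
    (∀ y → y ≢ r → depth y ≤ depth x → R y (parent y)) → Star R x r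
  descend-to-root {R} x up =
    let z , dz , s = descend 0 x z≤n (λ y 0<y → up y (<depth⇒≢root 0<y))
    in subst (Star R x) (depth≡0⇒root dz) s

  isParent : Fin n → Fin n → Bool
  isParent x y = not (does (x ≟ r)) ∧ does (y ≟ parent x)

  isParent-sound : ∀ x y → T (isParent x y) → x ≢ r × y ≡ parent x
  isParent-sound x y t with x ≟ r | y ≟ parent x
  ... | no x≢r | yes y≡p = x≢r , y≡p

  isParent-complete : ∀ {x} → x ≢ r → T (isParent x (parent x))
  isParent-complete {x} x≢r with x ≟ r | parent x ≟ parent x
  ... | yes x≡r | _     = contradiction x≡r x≢r
  ... | no _    | yes _ = _
  ... | no _    | no ≢p = contradiction refl ≢p

  isParent-asym : ∀ x y → T (isParent x y) → ¬ T (isParent y x)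
  isParent-asym x y xy yx with isParent-sound x y xy
  ... | x≢r , refl with isParent-sound y x yx
  ... | p≢r , x≡pp = depth<⇒≢ (<-trans (parent< p≢r) (parent< x≢r)) (sym x≡pp)

  isParent-count : sum (λ x → sum (λ y → ι (isParent x y))) + 1 ≡ n
  isParent-count = begin
    sum (λ x → sum (λ y → ι (isParent x y))) + 1
      ≡⟨ cong₂ _+_ (sum-cong-≗ row) (sym (sum-δ r)) ⟩
    sum (λ x → ι (not (does (x ≟ r)))) + sum (δ r)
      ≡⟨ sym (∑-distrib-+ (λ x → ι (not (does (x ≟ r)))) (δ r)) ⟩
    sum (λ x → ι (not (does (x ≟ r))) + δ r x)
      ≡⟨ sum-cong-≗ (λ x → one (does (x ≟ r))) ⟩
    sum {n} (λ _ → 1)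
      ≡⟨ trans (sum-const {n} 1) (*-identityʳ n) ⟩
    n ∎
    where
    open ≡-Reasoning
    one : ∀ b → ι (not b) + ι b ≡ 1
    one true  = refl
    one false = refl
    ι-∧ : ∀ b c → ι (b ∧ c) ≡ ι b * ι c
    ι-∧ true  c = sym (*-identityˡ (ι c))
    ι-∧ false c = refl
    row : ∀ x → sum (λ y → ι (isParent x y)) ≡ ι (not (does (x ≟ r)))
    row x = trans (sum-cong-≗ (λ y → ι-∧ (not (does (x ≟ r))) (does (y ≟ parent x))))
                  (sum-*δ (ι (not (does (x ≟ r)))) (parent x))

  -- Every vertex but the root has exactly one parent, and counting both orientations doubles this
  -- to 2(n - 1).
  isParent-size : sum (λ x → sum (λ y → ι (isParent x y) + ι (isParent y x))) + 2 ≡ n + n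
  isParent-size = begin
    sum (λ x → sum (λ y → ι (isParent x y) + ι (isParent y x))) + 2
      ≡⟨ cong (_+ 2) (sum-cong-≗ (λ x → ∑-distrib-+ (λ y → ι (isParent x y)) _)) ⟩
    sum (λ x → sum (λ y → ι (isParent x y)) + sum (λ y → ι (isParent y x))) + 2
      ≡⟨ cong (_+ 2) (∑-distrib-+ (λ x → sum (λ y → ι (isParent x y))) _) ⟩
    P + sum (λ x → sum (λ y → ι (isParent y x))) + 2
      ≡⟨ cong (λ s → P + s + 2) (∑-comm (λ x y → ι (isParent y x))) ⟩
    P + P + 2
      ≡⟨ +-interchange P P 1 1 ⟩
    (P + 1) + (P + 1)
      ≡⟨ cong₂ _+_ isParent-count isParent-count ⟩
    n + n ∎
    where
    open ≡-Reasoning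
    P = sum (λ x → sum (λ y → ι (isParent x y)))

  isParent≤adj : ∀ x y → ι (isParent x y) + ι (isParent y x) ≤ ι (adj G x y)
  isParent≤adj x y with T? (isParent x y) | T? (isParent y x)
  ... | yes xy | yes yx = contradiction yx (isParent-asym x y xy)
  ... | yes xy | no ¬yx with isParent-sound x y xy
  ...   | x≢r , refl rewrite ι-T xy | ι-¬T ¬yx = ≤-reflexive (sym (ι-T (parent-adj x≢r)))
  isParent≤adj x y | no ¬xy | yes yx with isParent-sound y x yx
  ...   | y≢r , refl rewrite ι-T yx | ι-¬T ¬xy = ≤-reflexive (sym (ι-T (Adj-sym G (parent-adj y≢r))))
  isParent≤adj x y | no ¬xy | no ¬yx rewrite ι-¬T ¬xy | ι-¬T ¬yx = z≤n

  private
    sum-deg≡ : sum (deg G) ≡ sum (λ x → sum (λ y → ι (adj G x y)))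
    sum-deg≡ = sum-cong-≗ (deg≡sum G)

  -- The parent edges alone already contribute 2(n - 1) to the degree sum.
  size-lower-bound : n + n ≤ sum (deg G) + 2
  size-lower-bound = subst (_≤ sum (deg G) + 2) isParent-size (+-monoˡ-≤ 2
    (≤-trans (sum-mono-≤ (λ x → sum-mono-≤ (isParent≤adj x))) (≤-reflexive (sym sum-deg≡))))

  -- With only n - 1 edges in the graph, the parent edges exhaust them: equality of the totals
  -- forces equality in `isParent≤adj` at every pair.
  tree-edge : sum (deg G) + 2 ≡ n + n → ∀ {x y} → Adj G x y →
    (x ≢ r × y ≡ parent x) ⊎ (y ≢ r × x ≡ parent y)
  tree-edge size {x} {y} xy with T? (isParent x y) | T? (isParent y x)
  ... | yes p | _     = inj₁ (isParent-sound x y p)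
  ... | no _  | yes q = inj₂ (isParent-sound y x q)
  ... | no ¬p | no ¬q = contradiction
    (trans (sym (ι-T xy)) (trans (sym equal) (cong₂ _+_ (ι-¬T ¬p) (ι-¬T ¬q)))) (λ ())
    where
    rows : ∀ x → sum (λ y → ι (isParent x y) + ι (isParent y x)) ≡ sum (λ y → ι (adj G x y))
    rows = sum-≤⇒≡ (λ x → sum-mono-≤ (isParent≤adj x))
      (≤-reflexive (+-cancelʳ-≡ 2 _ _ (trans (cong (_+ 2) (sym sum-deg≡)) (trans size (sym isParent-size)))))
    equal : ι (isParent x y) + ι (isParent y x) ≡ ι (adj G x y)
    equal = sum-≤⇒≡ (isParent≤adj x) (≤-reflexive (sym (rows x))) y

-- Spanning trees

-- Trees are encoded as connected graphs with n - 1 edges, a condition that is easily checked after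
-- an exchange of edges. Acyclicity is derived from it in `acyclic`.
record Tree (G T' : Graph n) : Set where
  field
    subgraph : ∀ {x y} → Adj T' x y → Adj G x y
    linked   : Linked T'
    size     : sum (deg T') + 2 ≡ n + n

searchTree : {G : Graph n} {r : Fin n} → Rooted G r → ∃ (Tree G)
searchTree {n} {G} {r} ρ = S , record { subgraph = sub ; linked = link ; size = sz }
  where
  open Rooted ρ
  S : Graph n
  S = record
    { adj    = λ x y → isParent ρ x y ∨ isParent ρ y x
    ; sym    = λ x y → ∨-comm (isParent ρ x y) _
    ; irrefl = irr
    }
    where
    irr : ∀ x → isParent ρ x x ∨ isParent ρ x x ≡ false
    irr x with isParent ρ x x in eq
    ... | false = refl
    ... | true  = let t = subst T (sym eq) _ in contradiction t (isParent-asym ρ x x t)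
  sub : ∀ {x y} → Adj S x y → Adj G x y
  sub {x} {y} xy with isParent ρ x y in p | isParent ρ y x in q
  ... | true  | _    with isParent-sound ρ x y (subst T (sym p) _)
  ...   | x≢r , refl = parent-adj x≢r
  sub {x} {y} xy | false | true with isParent-sound ρ y x (subst T (sym q) _)
  ...   | y≢r , refl = Adj-sym G (parent-adj y≢r)
  to-root : ∀ x → Star (Adj S) x r
  to-root x = descend-to-root ρ x (λ y y≢r _ → up y (isParent-complete ρ y≢r))
    where
    up : ∀ y → T (isParent ρ y (parent y)) → Adj S y (parent y)
    up y t with isParent ρ y (parent y)
    ... | true = _
  link : Linked S
  link x y = to-root x ◅◅ Star-reverse S (to-root y)
  sz : sum (deg S) + 2 ≡ n + n
  sz = trans (cong (_+ 2) (sum-cong-≗ (λ x → trans (deg≡sum S x) (sum-cong-≗ (split x))))) (isParent-size ρ)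
    where
    split : ∀ x y → ι (isParent ρ x y ∨ isParent ρ y x) ≡ ι (isParent ρ x y) + ι (isParent ρ y x)
    split x y with isParent ρ x y in p | isParent ρ y x in q
    ... | false | _     = refl
    ... | true  | false = refl
    ... | true  | true  = contradiction (subst T (sym q) _) (isParent-asym ρ x y (subst T (sym p) _))

-- Every passage along the deleted edge is replaced by the detour from `a` to `b`.
delEdge-linked : (G : Graph n) {a b : Fin n} → Linked G → Star (Adj (delEdge G a b)) a b → Linked (delEdge G a b)
delEdge-linked G {a} {b} link ab x y = fold (Star (Adj (delEdge G a b))) (λ e s → detour e ◅◅ s) ε (link x y)
  where
  detour : ∀ {x y} → Adj G x y → Star (Adj (delEdge G a b)) x y
  detour {x} {y} xy with T? (edge a b x y)
  ... | no ¬e = delEdge-keep G xy ¬e ◅ ε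
  ... | yes e with edge-ends {x = x} {y} e
  ...   | inj₁ (refl , refl) = ab
  ...   | inj₂ (refl , refl) = Star-reverse (delEdge G a b) ab

sum-deg-delEdge : (G : Graph n) {a b : Fin n} → Adj G a b → sum (deg (delEdge G a b)) + 2 ≡ sum (deg G)
sum-deg-delEdge G {a} {b} ab = begin
  sum (deg (delEdge G a b)) + 2
    ≡⟨ cong (sum (deg (delEdge G a b)) +_) (sym (sum-δ+δ)) ⟩
  sum (deg (delEdge G a b)) + sum (λ x → δ a x + δ b x)
    ≡⟨ sym (∑-distrib-+ (deg (delEdge G a b)) _) ⟩
  sum (λ x → deg (delEdge G a b) x + (δ a x + δ b x))
    ≡⟨ sum-cong-≗ (deg-delEdge G ab) ⟩
  sum (deg G) ∎
  where
  open ≡-Reasoning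
  sum-δ+δ : sum (λ x → δ a x + δ b x) ≡ 2
  sum-δ+δ = trans (∑-distrib-+ (δ a) (δ b)) (cong₂ _+_ (sum-δ a) (sum-δ b))

walk-start : {G : Graph n} {P : Fin n → Set} → ∀ {x y xs} → Walk G x y xs → All P xs → P x
walk-start (here _)   (p ∷ _) = p
walk-start (step _ _) (p ∷ _) = p

walk-end : {G : Graph n} {P : Fin n → Set} → ∀ {x y xs} → Walk G x y xs → All P xs → P y
walk-end (here _)   (p ∷ _)  = p
walk-end (step _ w) (_ ∷ ps) = walk-end w ps

-- Deleting the edge that closes a cycle would leave a connected graph with n - 2 edges. The rest of
-- the cycle is the detour: its first edge does not end in `v`, as the cycle has at least three
-- vertices, and the later ones avoid `u`.
acyclic : {G T' : Graph n} → Tree G T' → ¬ HasCycle T'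
acyclic _ (u , v , _ , here _ , _ , s≤s () , _)
acyclic _ (u , v , _ , step _ (here _) , _ , s≤s (s≤s ()) , _)
acyclic {n} {G} {T'} tree (u , v , _ , step {w = w} uw (step wx walk) , (u∉ ∷ (w∉ ∷ _)) , _ , vu) =
  <⇒≱ short (size-lower-bound (root (delEdge T' u v) u
    (delEdge-linked T' linked (keep uw not-uv ◅ avoid (step wx walk) u∉))))
  where
  open Tree tree
  keep = delEdge-keep T' {u} {v}
  not-uv : ¬ T (edge u v u w)
  not-uv e with edge-ends {x = u} {w} e
  ... | inj₁ (_ , w≡v)   = walk-end walk w∉ w≡v
  ... | inj₂ (_ , w≡u)   = walk-start (step wx walk) u∉ (sym w≡u)
  avoid : ∀ {x xs} → Walk T' x v xs → All (u ≢_) xs → Star (Adj (delEdge T' u v)) x v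
  avoid (here _) _ = ε
  avoid (step {x} {y} xy walk) (u≢x ∷ u∉) = keep xy not-edge ◅ avoid walk u∉
    where
    not-edge : ¬ T (edge u v x y)
    not-edge e with edge-ends {x = x} {y} e
    ... | inj₁ (x≡u , _) = u≢x (sym x≡u)
    ... | inj₂ (_ , y≡u) = walk-start walk u∉ (sym y≡u)
  short : sum (deg (delEdge T' u v)) + 2 < n + n
  short = subst (_< n + n) (sym (sum-deg-delEdge T' (Adj-sym T' vu)))
    (subst (sum (deg T') <_) size (m<m+n _ (s≤s z≤n)))

Tree⇒IsSpanningTree : {G T' : Graph n} → Tree G T' → IsSpanningTree G T'
Tree⇒IsSpanningTree tree = (λ _ _ → subgraph) , Linked⇒Connected linked , acyclic tree
  where open Tree tree

-- Exchanging edges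

two : ℕ → ℕ
two m = ι (m ≡ᵇ 2)

twos : Graph n → ℕ
twos G = sum (λ x → two (deg G x))

two≤1 : ∀ m → two m ≤ 1
two≤1 m = ι≤1 (m ≡ᵇ 2)

two-≥3 : ∀ {m} → 3 ≤ m → two m ≡ 0
two-≥3 (s≤s (s≤s (s≤s _))) = refl

twos≤n : (G : Graph n) → twos G ≤ n
twos≤n {n} G = ≤-trans (sum-mono-≤ (λ x → two≤1 (deg G x))) (≤-reflexive (trans (sum-const {n} 1) (*-identityʳ n)))

private
  -- This and the next four lemmas settle the cases of the pointwise comparisons below; the summands
  -- 0 and 1 are the values that the `δ` terms take at the vertex in question.
  gain-leaf : ∀ {m m′} → m ≡ 1 → m′ + 0 ≡ m + 1 → two m + 1 ≤ two m′ + 0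
  gain-leaf {m′ = m′} refl eq rewrite trans (sym (+-identityʳ m′)) eq = ≤-refl

  keep-leaf : ∀ {m} k → m ≡ 1 → two m + 1 ≤ k + 1
  keep-leaf k refl = m≤n+m 1 k

  keep-big : ∀ {m} k → 3 ≤ m → two m + 0 ≤ k
  keep-big k 3≤m rewrite two-≥3 3≤m = z≤n

  lose-one : ∀ m k → two m + 0 ≤ k + 1
  lose-one m k = ≤-trans (≤-reflexive (+-identityʳ _)) (≤-trans (two≤1 m) (m≤n+m 1 k))

  keep-same : ∀ {m m′} → m′ ≡ m → two m + 0 ≤ two m′ + 0
  keep-same refl = ≤-refl

  sum-+δ : (f : Fin n → ℕ) (a : Fin n) → sum (λ x → f x + δ a x) ≡ sum f + 1
  sum-+δ f a = trans (∑-distrib-+ f (δ a)) (cong (sum f +_) (sum-δ a))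

  sum-+δ+*δ : (f : Fin n → ℕ) (a b : Fin n) (c : ℕ) → sum (λ x → f x + (δ a x + c * δ b x)) ≡ sum f + (1 + c)
  sum-+δ+*δ f a b c = trans (∑-distrib-+ f (λ x → δ a x + c * δ b x))
    (cong (sum f +_) (trans (∑-distrib-+ (δ a) (λ x → c * δ b x)) (cong₂ _+_ (sum-δ a) (sum-*δ c b))))

  sum-deg-addEdge : (G : Graph n) {a b : Fin n} (a≢b : a ≢ b) → ¬ Adj G a b →
    sum (deg (addEdge G a≢b)) ≡ sum (deg G) + 2
  sum-deg-addEdge G {a} {b} a≢b ¬ab = trans (sum-cong-≗ (deg-addEdge G a≢b ¬ab))
    (trans (∑-distrib-+ (deg G) (λ x → δ a x + δ b x))
      (cong (sum (deg G) +_) (trans (∑-distrib-+ (δ a) (δ b)) (cong₂ _+_ (sum-δ a) (sum-δ b)))))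

module Swap {G T' : Graph n} (tree : Tree G T') {v w a b : Fin n}
  (v≢w : v ≢ w) (vw : Adj G v w) (¬vw : ¬ Adj T' v w) (ab : Adj T' a b) where
  open Tree tree

  S : Graph n
  S = delEdge (addEdge T' v≢w) a b

  degree : ∀ x → deg S x + (δ a x + δ b x) ≡ deg T' x + (δ v x + δ w x)
  degree x = trans (deg-delEdge (addEdge T' v≢w) (addEdge-old T' v≢w ab) x) (deg-addEdge T' v≢w ¬vw x)

  old : ∀ {x y} → Adj T' x y → ¬ T (edge a b x y) → Adj S x y
  old xy ¬e = delEdge-keep (addEdge T' v≢w) (addEdge-old T' v≢w xy) ¬e

  new : Adj S v w
  new = delEdge-keep (addEdge T' v≢w) (addEdge-new T' v≢w) not-ab
    where
    not-ab : ¬ T (edge a b v w)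
    not-ab e with edge-ends {x = v} {w} e
    ... | inj₁ (refl , refl) = ¬vw ab
    ... | inj₂ (refl , refl) = ¬vw (Adj-sym T' ab)

  origin : ∀ {x y} → Adj S x y → (Adj T' x y ⊎ T (edge v w x y)) × ¬ T (edge a b x y)
  origin xy = let xy⁺ , ¬e = delEdge-Adj (addEdge T' v≢w) xy in addEdge-Adj T' v≢w xy⁺ , ¬e

  -- The number of edges is unchanged, so only connectedness is at stake, and for that a path around
  -- the deleted edge suffices.
  swapped : Star (Adj S) a b → Tree G S
  swapped path = record
    { subgraph = λ {x} {y} xy → sub x y (proj₁ (origin xy))
    ; linked   = delEdge-linked (addEdge T' v≢w)
        (λ x y → fold (Star (Adj (addEdge T' v≢w))) (λ e s → addEdge-old T' v≢w e ◅ s) ε (linked x y)) path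
    ; size     = trans (sum-deg-delEdge (addEdge T' v≢w) (addEdge-old T' v≢w ab))
        (trans (sum-deg-addEdge T' v≢w ¬vw) size)
    }
    where
    sub : ∀ x y → Adj T' x y ⊎ T (edge v w x y) → Adj G x y
    sub x y (inj₁ xy) = subgraph xy
    sub x y (inj₂ e) with edge-ends {x = x} {y} e
    ... | inj₁ (refl , refl) = vw
    ... | inj₂ (refl , refl) = Adj-sym G vw

-- The tree T + uw - wz, where z is the neighbour of w towards the leaf u.
module Shift {G T' : Graph n} (tree : Tree G T') {u : Fin n} (du : deg T' u ≡ 1) (ρ : Rooted T' u)
  {w : Fin n} (uw : Adj G u w) (z≢u : Rooted.parent ρ w ≢ u) where
  open Rooted ρ

  z : Fin n
  z = parent w

  private
    u≢w : u ≢ w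
    u≢w = Adj⇒≢ G uw

    wz : Adj T' w z
    wz = parent-adj (u≢w ∘ sym)

    z<w : depth z < depth w
    z<w = parent< ρ (u≢w ∘ sym)

    -- A tree neighbour of `u` has depth at most one, so its parent would be `u`.
    ¬uw : ¬ Adj T' u w
    ¬uw uw = z≢u (depth≡0⇒root ρ (n≤0⇒n≡0 (≤-pred (≤-trans z<w
      (≤-trans (depth-adj uw) (s≤s (≤-reflexive depth-root)))))))

  open Swap tree u≢w uw ¬uw wz public

  private
    -- The path from `z` to the root stays at depth at most `depth z`, so it never meets the deeper
    -- vertex `w` and survives the deletion of `wz`.
    z→u : Star (Adj S) z u
    z→u = descend-to-root ρ z λ y y≢u y≤z → old (parent-adj y≢u) (not-wz y y≢u y≤z)
      where
      not-wz : ∀ y → y ≢ u → depth y ≤ depth z → ¬ T (edge w z y (parent y))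
      not-wz y y≢u y≤z e with edge-ends {x = y} {parent y} e
      ... | inj₁ (refl , _)   = <⇒≱ z<w y≤z
      ... | inj₂ (refl , p≡w) = <-asym z<w (subst (λ p → depth p < depth y) p≡w (parent< ρ y≢u))

  shifted : Tree G S
  shifted = swapped (Star-reverse S (z→u ◅◅ new ◅ ε))

  private
    -- The leaf `u` reaches degree two, `w` trades one neighbour for another, and only `z` may drop
    -- out of the count; `δ u` and `δ z` record the gain and the possible loss.
    gain : ∀ x → two (deg T' x) + δ u x ≤ two (deg S x) + δ z x
    gain x with x ≟ u | x ≟ w | x ≟ z | degree x
    ... | yes refl | yes refl | _        | _  = contradiction refl u≢w
    ... | yes refl | no _     | yes x≡z  | _  = contradiction (sym x≡z) z≢u
    ... | yes refl | no _     | no _     | eq = gain-leaf du eq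
    ... | no _     | yes refl | yes x≡z  | _  = contradiction x≡z (Adj⇒≢ T' wz)
    ... | no _     | yes refl | no _     | eq = keep-same (+-cancelʳ-≡ 1 _ _ eq)
    ... | no _     | no _     | yes refl | _  = lose-one (deg T' x) _
    ... | no _     | no _     | no _     | eq = keep-same (+-cancelʳ-≡ 0 _ _ eq)

    -- A branch vertex `z` was not counted before, so nothing is lost there.
    strict-gain : 3 ≤ deg T' z → ∀ x → two (deg T' x) + δ u x ≤ two (deg S x)
    strict-gain 3≤z x with x ≟ z | gain x
    ... | no _     | g = ≤-trans g (≤-reflexive (+-identityʳ _))
    ... | yes refl | _ rewrite δ-≢ z≢u = keep-big _ 3≤z

  twos-shift : twos T' ≤ twos S
  twos-shift = +-cancelʳ-≤ 1 _ _ (≤-trans (≤-reflexive (sym (sum-+δ (λ x → two (deg T' x)) u)))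
    (≤-trans (sum-mono-≤ gain) (≤-reflexive (sum-+δ (λ x → two (deg S x)) z))))

  twos-shift-< : 3 ≤ deg T' z → twos T' < twos S
  twos-shift-< 3≤z = ≤-trans (≤-reflexive (trans (+-comm 1 _) (sym (sum-+δ (λ x → two (deg T' x)) u))))
    (sum-mono-≤ (strict-gain 3≤z))

  deg-z : suc (deg S z) ≡ deg T' z
  deg-z with degree z
  ... | eq rewrite δ-refl z | δ-≢ z≢u | δ-≢ (Adj⇒≢ T' wz ∘ sym) =
    trans (+-comm 1 _) (trans eq (+-identityʳ _))

  deg-other : ∀ {x} → x ≢ u → x ≢ z → deg S x ≡ deg T' x
  deg-other {x} x≢u x≢z with degree x
  ... | eq rewrite δ-≢ x≢u | δ-≢ x≢z = +-cancelʳ-≡ (δ w x) _ _ (trans (cong (deg S x +_) (sym (+-identityʳ _))) eq)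

-- The path from a leaf v to the branch vertex t closest to it.
module Leg {T' : Graph n} {v : Fin n} (dv : deg T' v ≡ 1) (ρ : Rooted T' v)
  {t : Fin n} (3≤t : 3 ≤ deg T' t)
  (closest : ∀ y → 3 ≤ deg T' y → Rooted.depth ρ t ≤ Rooted.depth ρ y) where
  open Rooted ρ

  t≢v : t ≢ v
  t≢v refl = contradiction (subst (3 ≤_) dv 3≤t) (λ { (s≤s ()) })

  -- Up to the depth of `t` the tree is a single path. Two vertices in one layer would, by
  -- induction, have a common parent, which would be either the leaf `v` with two neighbours or a
  -- branch vertex closer than `t`.
  layer : ∀ k {x y} → depth x ≡ k → depth y ≡ k → k ≤ depth t → x ≡ y
  layer zero    dx dy _ = trans (depth≡0⇒root ρ dx) (sym (depth≡0⇒root ρ dy))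
  layer (suc k) {x} {y} dx dy k<t with x ≟ y
  ... | yes x≡y = x≡y
  ... | no x≢y  = ⊥-elim (impossible (parent x ≟ v))
    where
    x≢v : x ≢ v
    x≢v = <depth⇒≢root ρ (subst (0 <_) (sym dx) (s≤s z≤n))
    y≢v : y ≢ v
    y≢v = <depth⇒≢root ρ (subst (0 <_) (sym dy) (s≤s z≤n))
    px≡k : depth (parent x) ≡ k
    px≡k = suc-injective (trans (sym (depth-parent x≢v)) dx)
    px≡py : parent x ≡ parent y
    px≡py = layer k px≡k (suc-injective (trans (sym (depth-parent y≢v)) dy)) (<⇒≤ k<t)
    px-x : Adj T' (parent x) x
    px-x = Adj-sym T' (parent-adj x≢v)
    px-y : Adj T' (parent x) y
    px-y = subst (λ p → Adj T' p y) (sym px≡py) (Adj-sym T' (parent-adj y≢v))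
    impossible : Dec (parent x ≡ v) → ⊥
    impossible (yes p≡v) = contradiction
      (subst (2 ≤_) (trans (cong (deg T') p≡v) dv) (2≤deg T' px-x px-y x≢y)) (λ { (s≤s ()) })
    impossible (no p≢v) = <⇒≱ k<t (≤-trans (closest (parent x)
      (3≤deg T' px-x px-y (parent-adj p≢v) x≢y (above x dx) (above y dy))) (≤-reflexive px≡k))
      where
      above : ∀ y → depth y ≡ suc k → y ≢ parent (parent x)
      above y dy = depth<⇒≢ ρ (<-trans (parent< ρ p≢v)
        (subst (depth (parent x) <_) (sym dy) (s≤s (≤-reflexive px≡k)))) ∘ sym

  -- Layers being single vertices, `x` is the parent of the vertex one layer further out; with its
  -- own parent this makes two neighbours, and a third contradicts the choice of `t`.
  inner : ∀ {x} → x ≢ v → depth x < depth t → deg T' x ≡ 2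
  -- The relation is trivial, since only the existence of a vertex at that depth matters.
  inner {x} x≢v x<t with descend ρ {R = λ _ _ → T true} (suc (depth x)) t x<t (λ _ _ _ → _)
  ... | y , dy , _ = ≤-antisym
    (≮⇒≥ (λ 3≤x → <⇒≱ x<t (closest x 3≤x)))
    (2≤deg T' (parent-adj x≢v) x-y (depth<⇒≢ ρ (<-trans (parent< ρ x≢v) (≤-reflexive (sym dy)))))
    where
    y≢v : y ≢ v
    y≢v = <depth⇒≢root ρ (≤-reflexive (sym dy))
    x-y : Adj T' x y
    x-y = subst (λ p → Adj T' p y)
      (layer (depth x) (suc-injective (trans (sym (depth-parent y≢v)) dy)) refl (<⇒≤ x<t))
      (Adj-sym T' (parent-adj y≢v))

  beyond : ∀ {x} → x ≢ v → x ≢ t → deg T' x ≢ 2 → depth t < depth x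
  beyond x≢v x≢t dx = ≤∧≢⇒< (≮⇒≥ (λ x<t → dx (inner x≢v x<t)))
    (λ t≡x → x≢t (layer (depth t) (sym t≡x) refl ≤-refl))

  q : Fin n
  q = parent t

  q<t : depth q < depth t
  q<t = parent< ρ t≢v

  -- The leg of v is cut off at t and hung, by its other end v, from w.
  module Move {G : Graph n} (tree : Tree G T') {w : Fin n} (vw : Adj G v w) (w≢t : w ≢ t) (dw : deg T' w ≢ 2) where

    private
      v≢w : v ≢ w
      v≢w = Adj⇒≢ G vw

      t<w : depth t < depth w
      t<w = beyond (v≢w ∘ sym) w≢t dw

      ¬vw : ¬ Adj T' v w
      ¬vw vw = <⇒≱ (≤-trans (s≤s (≤-trans (s≤s z≤n) q<t)) t<w)
        (≤-trans (depth-adj vw) (s≤s (≤-reflexive depth-root)))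

    open Swap tree v≢w vw ¬vw (parent-adj t≢v) public

    private
      -- The descent from `w` uses parent edges of vertices deeper than `t` only, never `tq`, and
      -- the vertex it reaches at depth `depth t` can only be `t`.
      w→t : Star (Adj S) w t
      w→t with descend ρ {R = Adj S} (depth t) w (<⇒≤ t<w)
                 (λ y t<y _ → old (parent-adj (<depth⇒≢root ρ t<y)) (not-tq y t<y))
        where
        not-tq : ∀ y → depth t < depth y → ¬ T (edge t q y (parent y))
        not-tq y t<y e with edge-ends {x = y} {parent y} e
        ... | inj₁ (refl , _) = <-irrefl refl t<y
        ... | inj₂ (refl , _) = <-asym t<y q<t
      ... | x , dx , s = subst (Star (Adj S) w) (layer (depth t) dx refl ≤-refl) s

      q→v : Star (Adj S) q v
      q→v = descend-to-root ρ q (λ y y≢v y≤q → old (parent-adj y≢v) (not-tq y y≢v y≤q))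
        where
        not-tq : ∀ y → y ≢ v → depth y ≤ depth q → ¬ T (edge t q y (parent y))
        not-tq y y≢v y≤q e with edge-ends {x = y} {parent y} e
        ... | inj₁ (refl , _)   = <⇒≱ q<t y≤q
        ... | inj₂ (refl , p≡t) = <-asym q<t (subst (λ p → depth p < depth y) p≡t (parent< ρ y≢v))

    moved : Tree G S
    moved = swapped (Star-reverse S (q→v ◅◅ new ◅ w→t))

    private
      q≢t : q ≢ t
      q≢t = depth<⇒≢ ρ q<t

      w≢q : w ≢ q
      w≢q = depth<⇒≢ ρ (<-trans q<t t<w) ∘ sym

      -- Both `v` and `w` rise to degree two, `t` was not counted, and `q` is the only possible
      -- loss. If `q` is `v` itself, its degree stays one and its two marks cancel.
      leaf-gain : deg T' w ≡ 1 → ∀ x → two (deg T' x) + (δ v x + 1 * δ w x) ≤ two (deg S x) + δ q x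
      leaf-gain d1 x with x ≟ v | x ≟ w | x ≟ t | x ≟ q | degree x
      ... | yes refl | yes refl | _        | _        | _  = contradiction refl v≢w
      ... | yes refl | no _     | yes refl | _        | _  = contradiction refl t≢v
      ... | yes refl | no _     | no _     | yes _    | _  = keep-leaf _ dv
      ... | yes refl | no _     | no _     | no _     | eq = gain-leaf dv eq
      ... | no _     | yes refl | yes refl | _        | _  = contradiction refl w≢t
      ... | no _     | yes refl | no _     | yes x≡q  | _  = contradiction x≡q w≢q
      ... | no _     | yes refl | no _     | no _     | eq = gain-leaf d1 eq
      ... | no _     | no _     | yes refl | _        | _  = keep-big _ 3≤t
      ... | no _     | no _     | no _     | yes refl | _  = lose-one (deg T' x) _
      ... | no _     | no _     | no _     | no _     | eq = keep-same (+-cancelʳ-≡ 0 _ _ eq)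

      -- The gain at `v` pays for the possible loss at `q`, while `w` was not counted. What remains
      -- is a gain at `t` in case its degree drops to exactly two.
      branch-gain : 3 ≤ deg T' w → ∀ x →
        two (deg T' x) + (δ v x + two (deg S t) * δ t x) ≤ two (deg S x) + δ q x
      branch-gain 3≤w = gain (deg S) degree
        where
        -- Only the balance of degrees matters, so `deg S` is replaced by any `d` satisfying it.
        gain : (d : Fin n → ℕ) → (∀ x → d x + (δ t x + δ q x) ≡ deg T' x + (δ v x + δ w x)) →
          ∀ x → two (deg T' x) + (δ v x + two (d t) * δ t x) ≤ two (d x) + δ q x
        gain d eqs x with x ≟ v | x ≟ w | x ≟ t | x ≟ q | eqs x
        ... | yes refl | yes refl | _        | _        | _  = contradiction refl v≢w
        ... | yes refl | no _     | yes refl | _        | _  = contradiction refl t≢v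
        ... | yes refl | no _     | no _     | yes _    | _  rewrite *-zeroʳ (two (d t)) = keep-leaf _ dv
        ... | yes refl | no _     | no _     | no _     | eq rewrite *-zeroʳ (two (d t)) = gain-leaf dv eq
        ... | no _     | yes refl | yes refl | _        | _  = contradiction refl w≢t
        ... | no _     | no _     | yes refl | _        | _
          rewrite two-≥3 3≤t | *-identityʳ (two (d t)) = m≤m+n _ _
        ... | no _     | yes refl | no _     | _        | _  rewrite *-zeroʳ (two (d t)) = keep-big _ 3≤w
        ... | no _     | no _     | no _     | yes refl | _  rewrite *-zeroʳ (two (d t)) = lose-one (deg T' x) _
        ... | no _     | no _     | no _     | no _     | eq rewrite *-zeroʳ (two (d t)) =
          keep-same (+-cancelʳ-≡ 0 _ _ eq)

      total : ∀ c y → (∀ x → two (deg T' x) + (δ v x + c * δ y x) ≤ two (deg S x) + δ q x) → twos T' + c ≤ twos S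
      total c y g = +-cancelʳ-≤ 1 _ _ (≤-trans
        (≤-reflexive (trans (+-assoc (twos T') c 1) (trans (cong (twos T' +_) (+-comm c 1))
          (sym (sum-+δ+*δ (λ x → two (deg T' x)) v y c)))))
        (≤-trans (sum-mono-≤ g) (≤-reflexive (sum-+δ (λ x → two (deg S x)) q))))

    twos-leaf : deg T' w ≡ 1 → twos T' < twos S
    twos-leaf d1 = ≤-trans (≤-reflexive (+-comm 1 _)) (total 1 w (leaf-gain d1))

    twos-branch : 3 ≤ deg T' w → twos T' + two (deg S t) ≤ twos S
    twos-branch 3≤w = total (two (deg S t)) t (branch-gain 3≤w)

    deg-t : suc (deg S t) ≡ deg T' t
    deg-t with degree t
    ... | eq rewrite δ-refl t | δ-≢ (q≢t ∘ sym) | δ-≢ t≢v | δ-≢ (w≢t ∘ sym) =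
      trans (+-comm 1 _) (trans eq (+-identityʳ _))

    shrink : ∀ {x} → x ≢ v → x ≢ w → deg S x ≤ deg T' x
    shrink {x} x≢v x≢w with degree x
    ... | eq rewrite δ-≢ x≢v | δ-≢ x≢w = ≤-trans (m≤m+n _ _) (≤-reflexive (trans eq (+-identityʳ _)))

-- Leaves and pendant paths

-- Walks away from the root inside `X`: a vertex that is not a leaf has a neighbour other than its
-- parent, which in a tree is a child.
leaf-below : {G T' : Graph n} → Tree G T' → ∀ {r} (ρ : Rooted T' r) {X : Fin n → Set} →
  (∀ {x} → X x → x ≢ r) → (∀ {y} → y ≢ r → X (Rooted.parent ρ y) → X y) →
  ∃ X → ∃ λ x → X x × deg T' x ≡ 1
leaf-below {n} {T' = T'} tree {r} ρ {X} X≢r X-down (x₀ , Xx₀) = go (sum depth) x₀ Xx₀ (m≤m+n _ _)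
  where
  open Rooted ρ
  open Tree tree
  -- The counter `k` bounds how far the depth can still grow, as no depth exceeds `sum depth`.
  go : ∀ k x → X x → sum depth ≤ k + depth x → ∃ λ x → X x × deg T' x ≡ 1
  go k x Xx bound with 2 ≤? deg T' x
  ... | no 2≰d = x , Xx , ≤-antisym (≤-pred (≰⇒> 2≰d)) (1≤deg T' (parent-adj (X≢r Xx)))
  ... | yes 2≤d with another-neighbour T' 2≤d (parent x)
  ... | y , xy , y≢p with tree-edge ρ size xy
  ... | inj₁ (_ , y≡p) = contradiction y≡p y≢p
  ... | inj₂ (y≢r , refl) with k
  ...   | zero  = contradiction (≤-trans (term≤sum depth y) bound) (<⇒≱ (parent< ρ y≢r))
  ...   | suc k = go k y (X-down y≢r Xx)
    (≤-trans bound (≤-reflexive (trans (sym (+-suc k _)) (cong (k +_) (sym (depth-parent y≢r))))))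

-- X is a union of paths hanging from t, and t has at most one neighbour (exit) outside X.
record Pendant (T' : Graph n) (t : Fin n) (X : Fin n → Set) : Set where
  field
    closed : ∀ {x y} → X x → Adj T' x y → X y ⊎ y ≡ t
    thin   : ∀ {x} → X x → deg T' x ≤ 2
    apex∉  : ¬ X t
    exit   : Fin n
    exits  : ∀ {y} → Adj T' t y → y ≢ exit → X y

data Below {G : Graph n} {r : Fin n} (ρ : Rooted G r) (t : Fin n) (x : Fin n) : Set where
  child : x ≢ r → Rooted.parent ρ x ≡ t → Below ρ t x
  lower : x ≢ r → Below ρ t (Rooted.parent ρ x) → Below ρ t x

-- A branch vertex at maximum depth has only paths below it.
pendant : {G T' : Graph n} → Tree G T' → (∃ λ x → 3 ≤ deg T' x) →
  ∃ λ t → 3 ≤ deg T' t × ∃ (Pendant T' t)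
pendant {T' = T'} tree branch@(r , _) with root T' r (Tree.linked tree)
... | ρ with argmax (λ x → 3 ≤? deg T' x) (Rooted.depth ρ) branch
... | t , 3≤t , deepest = t , 3≤t , Below ρ t , record
  { closed = closed
  ; thin   = λ b → ≮⇒≥ (λ 3≤x → <⇒≱ (below-depth b) (deepest _ 3≤x))
  ; apex∉  = λ b → <-irrefl refl (below-depth b)
  -- If `t` is the root, all its neighbours are children and this value is arbitrary.
  ; exit   = parent t
  ; exits  = exits
  }
  where
  open Rooted ρ
  open Tree tree
  below-depth : ∀ {x} → Below ρ t x → depth t < depth x
  below-depth (child x≢r refl) = parent< ρ x≢r
  below-depth (lower x≢r b)    = <-trans (below-depth b) (parent< ρ x≢r)
  closed : ∀ {x y} → Below ρ t x → Adj T' x y → Below ρ t y ⊎ y ≡ t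
  closed b xy with tree-edge ρ size xy
  closed (child _ p≡t) xy | inj₁ (_ , refl)   = inj₂ p≡t
  closed (lower _ b)   xy | inj₁ (_ , refl)   = inj₁ b
  closed b             xy | inj₂ (y≢r , refl) = inj₁ (lower y≢r b)
  exits : ∀ {y} → Adj T' t y → y ≢ parent t → Below ρ t y
  exits ty y≢p with tree-edge ρ size ty
  ... | inj₁ (_ , y≡p)   = contradiction y≡p y≢p
  ... | inj₂ (y≢r , t≡p) = child y≢r (sym t≡p)

-- Counting

module _ {G T' : Graph n} {u v t : Fin n} (ρ : Rooted T' u) (u≢t : u ≢ t) (du : deg T' u ≡ 1)
  (next : ∀ w → Adj G u w → Rooted.parent ρ w ≢ u → deg T' (Rooted.parent ρ w) ≤ 2)
  (cross : ∀ w → Adj G u w → Rooted.parent ρ w ≢ u → ¬ Adj G v (Rooted.parent ρ w))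
  (thin : ∀ w → Adj G v w → w ≢ t → deg T' w ≡ 2) where
  open Rooted ρ

  private
    -- Indicator of `w` being a `G`-neighbour of `u` with parent `x`. Summed over `w`, it gives the
    -- size of the fibre of the parent map over `x`.
    through : Fin n → Fin n → ℕ
    through x w = ι (adj G u w) * δ (parent w) x

    through⁺ : ∀ x w → 0 < through x w → Adj G u w × x ≡ parent w
    through⁺ x w 0<f with adj G u w | x ≟ parent w
    ... | true | yes x≡p = _ , x≡p

    through≤1 : ∀ x w → through x w ≤ 1
    through≤1 x w = *-mono-≤ (ι≤1 (adj G u w)) (ι≤1 (does (x ≟ parent w)))

    sum-through : sum (λ x → sum (through x)) ≡ deg G u
    sum-through = trans (∑-comm through)
      (trans (sum-cong-≗ (λ w → sum-*δ (ι (adj G u w)) (parent w))) (sym (deg≡sum G u)))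

    to-child : ∀ {x w} → Adj G u w → x ≡ parent w → Adj T' x w
    to-child uw refl = Adj-sym T' (parent-adj (Adj⇒≢ G uw ∘ sym))

    -- Injectivity of the parent map on the neighbours of `u`: two of them with parent `x` would be
    -- two tree neighbours of the leaf `u`, or, together with the parent of `x`, three of `x`.
    through-unique : ∀ x → (x ≢ u → deg T' x ≤ 2) → sum (through x) ≤ 1
    through-unique x d≤2 = sum-unique≤1 (through x) (through≤1 x) unique
      where
      unique : ∀ w w′ → 0 < through x w → 0 < through x w′ → w ≡ w′
      unique w w′ f f′ with through⁺ x w f | through⁺ x w′ f′ | w ≟ w′ | x ≟ u
      ... | _ | _ | yes w≡w′ | _ = w≡w′
      ... | uw , x≡p | uw′ , x≡p′ | no w≢w′ | yes refl =
        contradiction (subst (2 ≤_) du (2≤deg T' (to-child uw x≡p) (to-child uw′ x≡p′) w≢w′)) (λ { (s≤s ()) })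
      ... | uw , x≡p | uw′ , x≡p′ | no w≢w′ | no x≢u =
        contradiction (d≤2 x≢u) (<⇒≱ (3≤deg T' (to-child uw x≡p) (to-child uw′ x≡p′) (parent-adj x≢u)
          w≢w′ (above uw x≡p) (above uw′ x≡p′)))
        where
        above : ∀ {w} → Adj G u w → x ≡ parent w → w ≢ parent x
        above uw refl = depth<⇒≢ ρ (<-trans (parent< ρ x≢u) (parent< ρ (Adj⇒≢ G uw ∘ sym))) ∘ sym

    ¬vu : ¬ Adj G v u
    ¬vu vu = contradiction (trans (sym du) (thin u vu u≢t)) (λ ())

    -- By `cross`, a vertex other than `u` is never counted both as a parent and as a neighbour of
    -- `v`. Counted once, it has degree two or is `t`; the vertex `u` is not adjacent to `v`.
    pointwise : ∀ x → sum (through x) + ι (adj G v x) ≤ two (deg T' x) + (δ u x + δ t x)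
    pointwise x with x ≟ u
    ... | yes refl rewrite ι-¬T ¬vu = ≤-trans (≤-reflexive (+-identityʳ _))
        (≤-trans (through-unique u (contradiction refl)) (≤-trans (m≤m+n 1 _) (m≤n+m _ (two (deg T' u)))))
    ... | no x≢u with any? (λ w → Adj? G u w ×-dec (x ≟ parent w))
    ...   | yes (w , uw , refl) rewrite ι-¬T (cross w uw x≢u) = ≤-trans (≤-reflexive (+-identityʳ _))
        (≤-trans (through-unique x (λ _ → next w uw x≢u)) (≤-trans (≤-reflexive (sym two≡1)) (m≤m+n _ _)))
      where
      two≡1 : two (deg T' x) ≡ 1
      two≡1 = cong two (≤-antisym (next w uw x≢u) (2≤deg T' (to-child uw refl) (parent-adj x≢u)
        (depth<⇒≢ ρ (<-trans (parent< ρ x≢u) (parent< ρ (Adj⇒≢ G uw ∘ sym))) ∘ sym)))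
    ...   | no none = ≤-trans (≤-reflexive (cong (_+ ι (adj G v x)) through≡0)) nbr
      where
      through≡0 : sum (through x) ≡ 0
      through≡0 = trans (sum-cong-≗ (λ w → n≤0⇒n≡0 (≮⇒≥ (λ 0<f → none (w , through⁺ x w 0<f)))))
        (sum-replicate-zero n)
      nbr : ι (adj G v x) ≤ two (deg T' x) + δ t x
      nbr with Adj? G v x | x ≟ t
      ... | no ¬vx | _       = ≤-trans (≤-reflexive (ι-¬T ¬vx)) z≤n
      ... | yes vx | yes _   = ≤-trans (ι≤1 _) (m≤n+m 1 _)
      ... | yes vx | no x≢t  = ≤-trans (ι≤1 _) (≤-trans (≤-reflexive (sym (cong two (thin x vx x≢t)))) (m≤m+n _ _))

  degree-sum-bound : deg G u + deg G v ≤ twos T' + 2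
  degree-sum-bound = begin
    deg G u + deg G v
      ≡⟨ cong₂ _+_ (sym sum-through) (deg≡sum G v) ⟩
    sum (λ x → sum (through x)) + sum (λ x → ι (adj G v x))
      ≡⟨ sym (∑-distrib-+ (λ x → sum (through x)) _) ⟩
    sum (λ x → sum (through x) + ι (adj G v x))
      ≤⟨ sum-mono-≤ pointwise ⟩
    sum (λ x → two (deg T' x) + (δ u x + δ t x))
      ≡⟨ ∑-distrib-+ (λ x → two (deg T' x)) _ ⟩
    twos T' + sum (λ x → δ u x + δ t x)
      ≡⟨ cong (twos T' +_) (trans (∑-distrib-+ (δ u) (δ t)) (cong₂ _+_ (sum-δ u) (sum-δ t))) ⟩
    twos T' + 2 ∎
    where open ≤-Reasoning

-- Branch degrees against vertices of degree two

branchWeight : ℕ → ℕ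
branchWeight d = if 3 ≤ᵇ d then d else 0

sum-map-tabulate : {A : Set} (f : A → ℕ) (g : Fin n → A) → listSum (map f (tabulate g)) ≡ sum (f ∘ g)
sum-map-tabulate {zero}  f g = refl
sum-map-tabulate {suc n} f g = cong (f (g zero) +_) (sum-map-tabulate f (g ∘ suc))

branchDegSum≡sum : (T' : Graph n) → branchDegSum T' ≡ sum (branchWeight ∘ deg T')
branchDegSum≡sum T' = sum-map-tabulate (branchWeight ∘ deg T') id

branchless : (T' : Graph n) → (∀ x → ¬ 3 ≤ deg T' x) → branchDegSum T' ≡ 0
branchless {n} T' none = trans (branchDegSum≡sum T')
  (trans (sum-cong-≗ (λ x → light (none x))) (sum-replicate-zero n))
  where
  light : ∀ {d} → ¬ 3 ≤ d → branchWeight d ≡ 0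
  light {0} _ = refl
  light {1} _ = refl
  light {2} _ = refl
  light {suc (suc (suc d))} ¬3≤d = contradiction (s≤s (s≤s (s≤s z≤n))) ¬3≤d

-- Equality holds for d = 1, 2, 3; beyond that, 2 d + 3 ≤ 3 d.
weight-bound : ∀ {d} → 1 ≤ d → 2 * branchWeight d + 3 * two d + 3 ≤ 3 * d
weight-bound {1} _ = ≤-refl
weight-bound {2} _ = ≤-refl
weight-bound {suc (suc (suc m))} _ = begin
  2 * (3 + m) + 0 + 3 ≡⟨ cong (_+ 3) (+-identityʳ (2 * (3 + m))) ⟩
  2 * (3 + m) + 3     ≤⟨ +-monoʳ-≤ (2 * (3 + m)) (m≤m+n 3 m) ⟩
  2 * (3 + m) + (3 + m) ≡⟨ +-comm (2 * (3 + m)) _ ⟩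
  3 * (3 + m)         ∎
  where open ≤-Reasoning

-- Sum of `weight-bound` over all vertices: the constant 3 adds up to 3 n, and three times the
-- degree sum is 6 n - 6.
branchDegSum-bound : {G T' : Graph n} → Tree G T' → (∀ x → 1 ≤ deg T' x) →
  2 * branchDegSum T' + 3 * twos T' + 6 ≤ 3 * n
branchDegSum-bound {n} {T' = T'} tree 1≤d = +-cancelʳ-≤ (3 * n) _ _ (begin
  2 * branchDegSum T' + 3 * twos T' + 6 + 3 * n
    ≡⟨ solve 3 (λ a d m → a :+ d :+ con 6 :+ con 3 :* m := a :+ d :+ m :* con 3 :+ con 6) refl
         (2 * branchDegSum T') (3 * twos T') n ⟩
  2 * branchDegSum T' + 3 * twos T' + n * 3 + 6
    ≡⟨ cong (_+ 6) (sym total) ⟩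
  sum (λ x → 2 * branchWeight (deg T' x) + 3 * two (deg T' x) + 3) + 6
    ≤⟨ +-monoˡ-≤ 6 (sum-mono-≤ (λ x → weight-bound (1≤d x))) ⟩
  sum (λ x → 3 * deg T' x) + 6
    ≡⟨ cong (_+ 6) (sum-* 3 (deg T')) ⟩
  3 * sum (deg T') + 3 * 2
    ≡⟨ sym (*-distribˡ-+ 3 (sum (deg T')) 2) ⟩
  3 * (sum (deg T') + 2)
    ≡⟨ trans (cong (3 *_) (Tree.size tree)) (*-distribˡ-+ 3 n n) ⟩
  3 * n + 3 * n ∎)
  where
  open ≤-Reasoning
  open +-*-Solver
  total : sum (λ x → 2 * branchWeight (deg T' x) + 3 * two (deg T' x) + 3) ≡ 2 * branchDegSum T' + 3 * twos T' + n * 3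
  total = trans (∑-distrib-+ (λ x → 2 * branchWeight (deg T' x) + 3 * two (deg T' x)) (λ _ → 3))
    (cong₂ _+_ (trans (∑-distrib-+ (λ x → 2 * branchWeight (deg T' x)) _)
      (cong₂ _+_ (trans (sum-* 2 (branchWeight ∘ deg T')) (cong (2 *_) (sym (branchDegSum≡sum T'))))
        (sum-* 3 (λ x → two (deg T' x)))))
      (sum-const {n} 3))

-- Improving a tree

Better : Graph n → ℕ → Set
Better G m = ∃ λ T' → Tree G T' × m < twos T'

Better-≤ : {G : Graph n} {m m′ : ℕ} → m ≤ m′ → Better G m′ → Better G m
Better-≤ m≤m′ (T' , tree , m′<) = T' , tree , ≤-<-trans m≤m′ m′<

1≱3 : ∀ {m} → m ≡ 1 → ¬ 3 ≤ m
1≱3 refl (s≤s ())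

-- The leg of `v` is cut at the branch vertex closest to `v` and hung from `w`: two leaves reach
-- degree two, and at most one vertex is lost.
join-leaves : {G T' : Graph n} → Tree G T' → (∃ λ x → 3 ≤ deg T' x) → ∀ {v w} →
  deg T' v ≡ 1 → deg T' w ≡ 1 → Adj G v w → Better G (twos T')
join-leaves {T' = T'} tree branch {v} {w} dv dw vw with root T' v (Tree.linked tree)
... | ρ with argmin (λ x → 3 ≤? deg T' x) (Rooted.depth ρ) branch
... | t , 3≤t , closest = S , moved , twos-leaf dw
  where
  open Leg dv ρ 3≤t closest
  open Move tree vw (λ w≡t → 1≱3 (trans (cong (deg T') (sym w≡t)) dw) 3≤t)
    (λ dw′ → contradiction (trans (sym dw) dw′) (λ ()))

module _ {G T' : Graph n} (tree : Tree G T') {t : Fin n} {X : Fin n → Set} (pend : Pendant T' t X)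
  (3≤t : 3 ≤ deg T' t) where
  open Tree tree
  open Pendant pend

  -- Some neighbour of `t` differs from `exit` and so lies in `X`; walking on away from `t` never
  -- leaves `X`.
  pendant-leaf : ∃ λ v → X v × deg T' v ≡ 1
  pendant-leaf with another-neighbour T' (<⇒≤ 3≤t) exit
  ... | c , tc , c≢exit = leaf-below tree ρ X≢t X-down (c , exits tc c≢exit)
    where
    ρ = root T' t linked
    open Rooted ρ
    X≢t : ∀ {x} → X x → x ≢ t
    X≢t Xx refl = apex∉ Xx
    X-down : ∀ {y} → y ≢ t → X (parent y) → X y
    X-down y≢t Xp with closed Xp (Adj-sym T' (parent-adj y≢t))
    ... | inj₁ Xy  = Xy
    ... | inj₂ y≡t = contradiction y≡t y≢t

  -- A path from `v` can leave `X` only through `t`, and `X` contains no branch vertex. So `t` has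
  -- the property that `Leg` asks for.
  pendant-closest : ∀ {v} → X v → (ρ : Rooted T' v) →
    ∀ y → 3 ≤ deg T' y → Rooted.depth ρ t ≤ Rooted.depth ρ y
  pendant-closest {v} Xv ρ y 3≤y with inside-or-far (depth y) y refl
    where
    open Rooted ρ
    inside-or-far : ∀ k y → depth y ≡ k → X y ⊎ depth t ≤ depth y
    inside-or-far zero    y dy = inj₁ (subst X (sym (depth≡0⇒root ρ dy)) Xv)
    inside-or-far (suc k) y dy
      with y≢v ← <depth⇒≢root ρ (≤-trans (s≤s (z≤n {k})) (≤-reflexive (sym dy)))
      with inside-or-far k (parent y) (suc-injective (trans (sym (depth-parent y≢v)) dy))
    ... | inj₂ t≤p = inj₂ (≤-trans t≤p (<⇒≤ (parent< ρ y≢v)))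
    ... | inj₁ Xp with closed Xp (Adj-sym T' (parent-adj y≢v))
    ...   | inj₁ Xy   = inj₁ Xy
    ...   | inj₂ refl = inj₂ ≤-refl
  ... | inj₁ Xy  = contradiction (thin Xy) (<⇒≱ 3≤y)
  ... | inj₂ t≤y = t≤y

  module _ {v : Fin n} (dv : deg T' v ≡ 1) (ρ : Rooted T' v)
    (closest : ∀ y → 3 ≤ deg T' y → Rooted.depth ρ t ≤ Rooted.depth ρ y) where
    open Rooted ρ
    open Leg dv ρ 3≤t closest

    module _ {w : Fin n} (vw : Adj G v w) (w≢t : w ≢ t) (dw : deg T' w ≢ 2) (3≤w : 3 ≤ deg T' w) where
      open Move tree vw w≢t dw

      -- Cutting off one leg at t leaves the others in place.
      pendant-move : Pendant S t (λ x → X x × depth t < depth x)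
      pendant-move = record
        { closed = λ {x} {y} → closed′ x y
        ; thin   = λ { (Xx , t<x) → ≤-trans (shrink (<depth⇒≢root ρ t<x) (X≢w Xx)) (thin Xx) }
        ; apex∉  = λ { (Xt , _) → apex∉ Xt }
        ; exit   = exit
        ; exits  = λ {y} → exits′ y
        }
        where
        X≢w : ∀ {x} → X x → x ≢ w
        X≢w Xx refl = <⇒≱ 3≤w (thin Xx)
        closed′ : ∀ x y → X x × depth t < depth x → Adj S x y → (X y × depth t < depth y) ⊎ y ≡ t
        closed′ x y (Xx , t<x) xy with proj₁ (origin xy)
        ... | inj₂ e with edge-ends {x = x} {y} e
        ...   | inj₁ (x≡v , _) = contradiction x≡v (<depth⇒≢root ρ t<x)
        ...   | inj₂ (x≡w , _) = contradiction x≡w (X≢w Xx)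
        closed′ x y (Xx , t<x) xy | inj₁ xy′ with closed Xx xy′
        ...   | inj₂ y≡t = inj₂ y≡t
        ...   | inj₁ Xy with depth t <? depth y
        ...     | yes t<y = inj₁ (Xy , t<y)
        -- Being adjacent to a vertex deeper than `t`, `y` lies exactly at the depth of `t`, where
        -- `t` is alone.
        ...     | no t≮y  = inj₂ (layer (depth t)
          (≤-antisym (≮⇒≥ t≮y) (≤-pred (≤-trans t<x (depth-adj (Adj-sym T' xy′))))) refl ≤-refl)
        exits′ : ∀ y → Adj S t y → y ≢ exit → X y × depth t < depth y
        exits′ y ty y≢exit with origin ty
        ... | inj₂ e , _ with edge-ends {x = t} {y} e
        ...   | inj₁ (t≡v , _) = contradiction t≡v t≢v
        ...   | inj₂ (t≡w , _) = contradiction (sym t≡w) w≢t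
        exits′ y ty y≢exit | inj₁ ty′ , ¬tq = exits ty′ y≢exit , ≤∧≢⇒< (≮⇒≥ not-above) not-level
          where
          not-level : depth t ≢ depth y
          not-level t≡y = Adj⇒≢ T' ty′ (layer (depth t) refl (sym t≡y) ≤-refl)
          -- The only neighbour of `t` nearer to `v` is `q`, and the edge `tq` is gone.
          not-above : ¬ depth y < depth t
          not-above y<t = ¬tq (subst (λ y → T (edge t q t y))
            (layer (depth q) refl (≤-antisym (≤-pred (≤-trans y<t (≤-reflexive (depth-parent t≢v))))
              (≤-pred (≤-trans (≤-reflexive (sym (depth-parent t≢v))) (depth-adj (Adj-sym T' ty′))))) (<⇒≤ q<t))
            (edge-refl t q))

Adequate : Graph n → Set
Adequate {n} G = ∃ λ T' → Tree G T' × (∀ x → 1 ≤ deg T' x) ×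
  ∃ λ u → ∃ λ v → u ≢ v × ¬ Adj G u v × deg G u + deg G v ≤ twos T' + 2

-- Induction on a bound `j` for the degree of `t`, which falls by one with each leg moved. Moving a
-- leg never lowers `twos`, so whatever improves the moved tree improves `T'` as well.
improve : {G : Graph n} → ∀ j {T'} → Tree G T' → ∀ {t X} → Pendant T' t X → 3 ≤ deg T' t → deg T' t ≤ j →
  Better G (twos T') ⊎ Adequate G
improve zero    tree pend 3≤t t≤j = contradiction (≤-trans 3≤t t≤j) (λ ())
improve {n} {G} (suc j) {T'} tree {t} pend 3≤t t≤j
  with v , Xv , dv ← pendant-leaf tree pend 3≤t
  with ρv ← root T' v (Tree.linked tree)
  with closest ← pendant-closest tree pend 3≤t Xv ρv
  -- A second leaf: rooted at `v`, the search may use every vertex except `v`.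
  with u , u≢v , du ← leaf-below tree ρv {_≢ v} id (λ y≢v _ → y≢v) (t , Leg.t≢v dv ρv 3≤t closest)
  with ρu ← root T' u (Tree.linked tree)
  = result
  where
  open Leg dv ρv 3≤t closest using (module Move)
  open Rooted ρu using (parent; parent-adj)

  1≤d : ∀ x → 1 ≤ deg T' x
  1≤d x with x ≟ v
  ... | yes refl = ≤-reflexive (sym dv)
  ... | no x≢v   = 1≤deg T' (Rooted.parent-adj ρv x≢v)

  u≢t : u ≢ t
  u≢t u≡t = 1≱3 (trans (cong (deg T') (sym u≡t)) du) 3≤t

  -- If `w` is a leaf, two leaves get joined. If it is a branch vertex, the leg of `v` moves to it:
  -- either `t` drops to degree two, which is a gain, or `t` is still a branch vertex and the
  -- induction continues.
  at-v : ∀ {w} → Adj G v w → w ≢ t → deg T' w ≢ 2 → Better G (twos T') ⊎ Adequate G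
  at-v {w} vw w≢t dw with 3 ≤? deg T' w
  ... | no 3≰w = inj₁ (S , moved , twos-leaf (≤-antisym (≤-pred (≤∧≢⇒< (≤-pred (≰⇒> 3≰w)) dw)) (1≤d w)))
    where open Move tree vw w≢t dw
  ... | yes 3≤w with 3 ≤? deg (Move.S tree vw w≢t dw) t
  ...   | no 3≰t = inj₁ (S , moved , ≤-trans
      (≤-reflexive (trans (+-comm 1 _) (cong (λ d → twos T' + two d) (sym d≡2)))) (twos-branch 3≤w))
    where
    open Move tree vw w≢t dw
    d≡2 : deg S t ≡ 2
    d≡2 = ≤-antisym (≤-pred (≰⇒> 3≰t)) (≤-pred (≤-trans 3≤t (≤-reflexive (sym deg-t))))
  ...   | yes 3≤t′ = step-down (improve j moved (pendant-move tree pend 3≤t dv ρv closest vw w≢t dw 3≤w) 3≤t′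
          (≤-pred (≤-trans (≤-reflexive deg-t) t≤j)))
    where
    open Move tree vw w≢t dw
    step-down : Better G (twos S) ⊎ Adequate G → Better G (twos T') ⊎ Adequate G
    step-down (inj₁ better) = inj₁ (Better-≤ (≤-trans (m≤m+n _ _) (twos-branch 3≤w)) better)
    step-down (inj₂ done)   = inj₂ done

  -- The shift costs nothing and turns `parent w` from a vertex of degree two into a leaf, while `v`
  -- stays a leaf and `t` a branch vertex; then the two leaves are joined.
  at-crossing : ∀ {w} → Adj G u w → parent w ≢ u → deg T' (parent w) ≤ 2 → Adj G v (parent w) → Better G (twos T')
  at-crossing {w} uw p≢u p≤2 vp = Better-≤ twos-shift
    (join-leaves shifted (t , subst (3 ≤_) (sym (deg-other (u≢t ∘ sym) t≢z)) 3≤t)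
      (trans (deg-other (u≢v ∘ sym) v≢z) dv) (suc-injective (trans deg-z dz)) vp)
    where
    open Shift tree du ρu uw p≢u
    dz : deg T' z ≡ 2
    dz = ≤-antisym p≤2 (2≤deg T' (parent-adj p≢u) (Adj-sym T' (parent-adj w≢u))
      (depth<⇒≢ ρu (<-trans (parent< ρu p≢u) (parent< ρu w≢u))))
      where
      w≢u : w ≢ u
      w≢u = Adj⇒≢ G uw ∘ sym
    t≢z : t ≢ z
    t≢z t≡z = <⇒≱ 3≤t (≤-reflexive (trans (cong (deg T') t≡z) dz))
    v≢z : v ≢ z
    v≢z v≡z = contradiction (trans (sym dv) (trans (cong (deg T') v≡z) dz)) (λ ())

  -- The obstructions are sought in turn; when none occurs, the hypotheses of `degree-sum-bound`
  -- hold.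
  result : Better G (twos T') ⊎ Adequate G
  result with any? (λ w → Adj? G v w ×-dec (¬? (w ≟ t) ×-dec ¬? (deg T' w ≟ℕ 2)))
  ... | yes (w , vw , w≢t , dw) = at-v vw w≢t dw
  ... | no ¬at-v with any? (λ w → Adj? G u w ×-dec (¬? (parent w ≟ u) ×-dec (3 ≤? deg T' (parent w))))
  ...   | yes (w , uw , p≢u , 3≤p) = inj₁ (S , shifted , twos-shift-< 3≤p)
    where open Shift tree du ρu uw p≢u
  ...   | no ¬at-u with any? (λ w → Adj? G u w ×-dec (¬? (parent w ≟ u) ×-dec Adj? G v (parent w)))
  ...     | yes (w , uw , p≢u , vp) = inj₁ (at-crossing uw p≢u (≮⇒≥ (λ 3≤p → ¬at-u (w , uw , p≢u , 3≤p))) vp)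
  ...     | no ¬crossing = inj₂ (T' , tree , 1≤d , u , v , u≢v , ¬uv , degree-sum-bound {G = G} {v = v} ρu u≢t du
              (λ w uw p≢u → ≮⇒≥ (λ 3≤p → ¬at-u (w , uw , p≢u , 3≤p)))
              (λ w uw p≢u vp → ¬crossing (w , uw , p≢u , vp)) thin)
    where
    thin : ∀ w → Adj G v w → w ≢ t → deg T' w ≡ 2
    thin w vw w≢t with deg T' w ≟ℕ 2
    ... | yes d≡2 = d≡2
    ... | no d≢2  = contradiction (w , vw , w≢t , d≢2) ¬at-v
    ¬uv : ¬ Adj G u v
    ¬uv uv = contradiction (trans (sym du) (thin u (Adj-sym G uv) u≢t)) (λ ())

-- Repeated improvement stops because `twos` never exceeds `n`; the counter `m` bounds the number of
-- improvements still possible.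
branchless-or-adequate : {G : Graph n} → ∀ m {T'} → Tree G T' → n ≤ m + twos T' →
  (∃ λ S → Tree G S × branchDegSum S ≡ 0) ⊎ Adequate G
branchless-or-adequate m {T'} tree n≤ with any? (λ x → 3 ≤? deg T' x)
... | no none = inj₁ (T' , tree , branchless T' (λ x 3≤x → none (x , 3≤x)))
... | yes branch with pendant tree branch
... | t , 3≤t , X , pend with improve (deg T' t) tree pend 3≤t ≤-refl
... | inj₂ done = inj₂ done
... | inj₁ (S , treeS , more) with m
...   | zero  = contradiction (≤-trans more (twos≤n S)) (≤⇒≯ n≤)
...   | suc m = branchless-or-adequate m treeS
  (≤-trans n≤ (≤-trans (≤-reflexive (sym (+-suc m _))) (+-monoʳ-≤ m more)))

theorem3 : (n : ℕ) → 0 < n → (G : Graph n) → Connected G →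
    (k : ℕ) → 0 < k → σ₂≥ G (n ∸ k + 1) →
    Σ (Graph n) (λ T' → IsSpanningTree G T' × 2 * branchDegSum T' ≤ 3 * (k ∸ 1))
theorem3 (suc n) _ G conn (suc k) _ σ₂
  with S , tree ← searchTree (root G zero (Connected⇒Linked conn))
  with branchless-or-adequate (suc n) tree (m≤m+n _ _)
... | inj₁ (T' , tree , B≡0) = T' , Tree⇒IsSpanningTree tree , ≤-trans (≤-reflexive (cong (2 *_) B≡0)) z≤n
... | inj₂ (T' , tree , 1≤d , u , v , u≢v , ¬uv , du+dv≤) = T' , Tree⇒IsSpanningTree tree , bound
  where
  open ≤-Reasoning
  open +-*-Solver
  B = branchDegSum T'
  D = twos T'
  -- Here `suc n` and `suc k` are the order and the parameter of the theorem. The estimate holds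
  -- also for k > n, where the difference is truncated to zero.
  order : suc n ≤ k + D + 2
  order = begin
    suc n                     ≤⟨ s≤s (m≤n+m∸n n k) ⟩
    suc (k + (n ∸ k))         ≡⟨ trans (sym (+-suc k _)) (cong (k +_) (+-comm 1 _)) ⟩
    k + (n ∸ k + 1)           ≤⟨ +-monoʳ-≤ k (≤-trans (σ₂ u v u≢v ¬uv) du+dv≤) ⟩
    k + (D + 2)               ≡⟨ sym (+-assoc k D 2) ⟩
    k + D + 2                 ∎
  bound : 2 * B ≤ 3 * k
  bound = +-cancelʳ-≤ (3 * D + 6) _ _ (begin
    2 * B + (3 * D + 6)  ≡⟨ sym (+-assoc (2 * B) _ 6) ⟩
    2 * B + 3 * D + 6    ≤⟨ branchDegSum-bound tree 1≤d ⟩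
    3 * suc n            ≤⟨ *-monoʳ-≤ 3 order ⟩
    3 * (k + D + 2)      ≡⟨ solve 2 (λ k d → con 3 :* (k :+ d :+ con 2) := con 3 :* k :+ (con 3 :* d :+ con 6)) refl k D ⟩
    3 * k + (3 * D + 6)  ∎)
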